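{- Let $\mathcal{S}=\mathcal{R}$ be one of the sets $\mathcal{R}_H,\mathcal{R}'_H,\mathcal{R}''_H$ for a subgroup $H=\{A_\lambda:\lambda\in V_3\}$ with $\mathbb{P}V_3$ of kind $\mathcal{P}_0$ (so $\mathcal{S}$ is a Segre variety $\mathcal{S}_3(2)$ in $\omega_4$), and let $\mathcal{R}$ be one of $\mathcal{R}_{K},\mathcal{R}'_{K},\mathcal{R}''_{K}$ for a subgroup $K\cong(Z_3)^3$ of $\mathcal{G}_{81}$ with $K\neq H$. Then the section $\mathcal{S}\cap\mathcal{R}$ is either (i) an $\mathcal{S}_2(2)$ contained in $\mathcal{S}$, or (ii) a $3$-generator set of $\mathcal{S}$, or (iii) a fan of $\mathcal{S}$.
   Context: Work over $\mathbb{F}_2$. $V_8=V(8,2)$ with basis $e_1,\dots,e_8$, $V_a=\langle e_1,e_8\rangle$, $V_b=\langle e_2,e_7\rangle$, $V_c=\langle e_3,e_6\rangle$, $V_d=\langle e_4,e_5\rangle$; points of $\operatorname{PG}(7,2)$ are nonzero vectors; $\omega_4$ is the set of vectors all four of whose components in $V_a,\dots,V_d$ are nonzero. Let $\zeta_a: e_1\mapsto e_8\mapsto e_1+e_8\mapsto e_1$, $\zeta_b: e_7\mapsto e_2\mapsto e_2+e_7\mapsto e_7$, $\zeta_c: e_3\mapsto e_6\mapsto e_3+e_6\mapsto e_3$, $\zeta_d: e_5\mapsto e_4\mapsto e_4+e_5\mapsto e_5$. For $\lambda=ijkl\in\mathbb{F}_3^4$ let $A_\lambda=\zeta_a^i\oplus\zeta_b^j\oplus\zeta_c^k\oplus\zeta_d^l$;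 these form $\mathcal{G}_{81}\cong(Z_3)^4$. Let $u=e_1+\dots+e_8$. For $H\cong(Z_3)^3$ in $\mathcal{G}_{81}$ with cosets $H,H',H''$ set $\mathcal{R}_H=\{hu:h\in H\}$, $\mathcal{R}'_H=\{hu:h\in H'\}$, $\mathcal{R}''_H=\{hu:h\in H''\}$. A plane $\mathbb{P}V_3$ of $\operatorname{PG}(3,3)=\mathbb{P}\mathbb{F}_3^4$ is of kind $\mathcal{P}_0$ if it contains none of $\langle1000\rangle,\langle0100\rangle,\langle0010\rangle,\langle0001\rangle$. A Segre variety $\mathcal{S}_3(2)$ is the image under a linear isomorphism $\phi:V(2,2)^{\otimes3}\to V_8$ of the set $\{x\otimes y\otimes z\}$ of nonzero pure tensors; its generators are the $27$ lines $\{\phi(v\otimes y\otimes z):v\neq0\}$, $\{\phi(x\otimes v\otimes z)\}$, $\{\phi(x\otimes y\otimes v)\}$. In these terms: an $\mathcal{S}_2(2)$ in $\mathcal{S}$ is a $9$-set of the form $\{\phi(x\otimes y\otimes z_0)\}$ with $z_0$ fixed (or the analogous set with another factor fixed); a $3$-generator set is a $9$-set $\{\phi(x_r\otimes y_r\otimes z): r=1,2,3,\ z\neq0\}$ where $x_1,x_2,x_3$ are distinct and $y_1,y_2,y_3$ are distinct (or the analogue with the factors permuted), i.e. three parallel generators meeting a perpendicular $\mathcal{S}_2(2)$ in three points no two on a common generator of it; a fan is a $9$-subset of $\mathcal{S}$ no two of whose points lie on a common generator. -}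

module Defs where

open import Data.Bool using (Bool; true; false; _xor_; _∧_; if_then_else_)
open import Data.Fin using (Fin; zero; suc)
open import Data.Nat using (ℕ)
open import Data.Vec using (Vec; []; _∷_; zipWith; map; replicate)
open import Data.Product using (Σ; ∃; ∃-syntax; Σ-syntax; _×_; _,_)
open import Data.Sum using (_⊎_)
open import Data.List using (List; length)
open import Data.List.Relation.Unary.Unique.Propositional using (Unique)
open import Data.List.Membership.Propositional using (_∈_)
open import Relation.Binary.PropositionalEquality using (_≡_; _≢_)
open import Relation.Nullary using (¬_)
open import Function.Bundles using (_⇔_)

F3 : Set
F3 = Fin 3

0₃ 1₃ 2₃ : F3
0₃ = zero
1₃ = suc zero
2₃ = suc (suc zero)

_+₃_ : F3 → F3 → F3
zero +₃ b = b
suc zero +₃ zero = 1₃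
suc zero +₃ suc zero = 2₃
suc zero +₃ suc (suc zero) = 0₃
suc (suc zero) +₃ zero = 2₃
suc (suc zero) +₃ suc zero = 0₃
suc (suc zero) +₃ suc (suc zero) = 1₃

-₃_ : F3 → F3
-₃ zero = 0₃
-₃ suc zero = 2₃
-₃ suc (suc zero) = 1₃

_*₃_ : F3 → F3 → F3
zero *₃ b = 0₃
suc zero *₃ b = b
suc (suc zero) *₃ b = -₃ b

F3⁴ : Set
F3⁴ = Vec F3 4

_⊕_ : F3⁴ → F3⁴ → F3⁴
_⊕_ = zipWith _+₃_

_⊖_ : F3⁴ → F3⁴ → F3⁴
x ⊖ y = x ⊕ map -₃_ y

_·_ : F3 → F3⁴ → F3⁴
a · x = map (a *₃_) x

𝟎 : F3⁴
𝟎 = replicate 4 0₃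

record Subspace3 : Set where
  field
    b₁ b₂ b₃ : F3⁴
    indep : ∀ a b c → (a · b₁) ⊕ ((b · b₂) ⊕ (c · b₃)) ≡ 𝟎 →
            (a ≡ 0₃) × (b ≡ 0₃) × (c ≡ 0₃)
open Subspace3 public

_∈V_ : F3⁴ → Subspace3 → Set
λ′ ∈V V = ∃[ a ] ∃[ b ] ∃[ c ] ((a · b₁ V) ⊕ ((b · b₂ V) ⊕ (c · b₃ V)) ≡ λ′)

SameSubspace : Subspace3 → Subspace3 → Set
SameSubspace V W = ∀ λ′ → (λ′ ∈V V) ⇔ (λ′ ∈V W)

KindP0 : Subspace3 → Set
KindP0 V = ¬ ((1₃ ∷ 0₃ ∷ 0₃ ∷ 0₃ ∷ []) ∈V V)
         × ¬ ((0₃ ∷ 1₃ ∷ 0₃ ∷ 0₃ ∷ []) ∈V V)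
         × ¬ ((0₃ ∷ 0₃ ∷ 1₃ ∷ 0₃ ∷ []) ∈V V)
         × ¬ ((0₃ ∷ 0₃ ∷ 0₃ ∷ 1₃ ∷ []) ∈V V)

-- V_8 = V(8,2): vectors are Vec Bool 8, position r-1 holds the
-- coefficient of e_r.

V8 : Set
V8 = Vec Bool 8

0₈ : V8
0₈ = replicate 8 false

_⊕₂_ : ∀ {n} → Vec Bool n → Vec Bool n → Vec Bool n
_⊕₂_ = zipWith _xor_

u : V8
u = replicate 8 true

Pair : Set
Pair = Bool × Bool

-- ζ_a : e1 ↦ e8 ↦ e1+e8 ↦ e1, acting on coordinates (x1 , x8)
ζa : Pair → Pair
ζa (x₁ , x₈) = (x₈ , x₁ xor x₈)
-- ζ_b : e7 ↦ e2 ↦ e2+e7 ↦ e7, acting on coordinates (x2 , x7)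
ζb : Pair → Pair
ζb (x₂ , x₇) = (x₂ xor x₇ , x₂)
-- ζ_c : e3 ↦ e6 ↦ e3+e6 ↦ e3, acting on coordinates (x3 , x6)
ζc : Pair → Pair
ζc (x₃ , x₆) = (x₆ , x₃ xor x₆)
-- ζ_d : e5 ↦ e4 ↦ e4+e5 ↦ e5, acting on coordinates (x4 , x5)
ζd : Pair → Pair
ζd (x₄ , x₅) = (x₄ xor x₅ , x₄)

pow : (Pair → Pair) → F3 → Pair → Pair
pow f zero p = p
pow f (suc zero) p = f p
pow f (suc (suc zero)) p = f (f p)

A : F3⁴ → V8 → V8
A (i ∷ j ∷ k ∷ l ∷ []) (x₁ ∷ x₂ ∷ x₃ ∷ x₄ ∷ x₅ ∷ x₆ ∷ x₇ ∷ x₈ ∷ []) =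
  let (y₁ , y₈) = pow ζa i (x₁ , x₈)
      (y₂ , y₇) = pow ζb j (x₂ , x₇)
      (y₃ , y₆) = pow ζc k (x₃ , x₆)
      (y₄ , y₅) = pow ζd l (x₄ , x₅)
  in y₁ ∷ y₂ ∷ y₃ ∷ y₄ ∷ y₅ ∷ y₆ ∷ y₇ ∷ y₈ ∷ []

-- The point set {h u : h ∈ coset μ H} where H = {A_λ : λ ∈ V} and the
-- coset is {A_λ : λ ∈ μ + V}.  As μ ranges over F_3^4 this gives
-- R_H, R'_H, R''_H.
CosetSet : Subspace3 → F3⁴ → V8 → Set
CosetSet V μ p = ∃[ λ′ ] ((λ′ ⊖ μ) ∈V V) × (A λ′ u ≡ p)

PtSet : Set₁
PtSet = V8 → Set

_≐_ : PtSet → PtSet → Set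
X ≐ Y = ∀ p → X p ⇔ Y p

_∩_ : PtSet → PtSet → PtSet
(X ∩ Y) p = X p × Y p

V2 : Set
V2 = Bool × Bool

NZ : V2 → Set
NZ x = x ≢ (false , false)

-- V(2,2)^{⊗3}, coordinates w.r.t. e_i ⊗ e_j ⊗ e_k in lexicographic order
Tensor : Set
Tensor = Vec Bool 8

_⊗_⊗_ : V2 → V2 → V2 → Tensor
(x₀ , x₁) ⊗ (y₀ , y₁) ⊗ (z₀ , z₁) =
    (x₀ ∧ y₀ ∧ z₀) ∷ (x₀ ∧ y₀ ∧ z₁) ∷ (x₀ ∧ y₁ ∧ z₀) ∷ (x₀ ∧ y₁ ∧ z₁)
  ∷ (x₁ ∧ y₀ ∧ z₀) ∷ (x₁ ∧ y₀ ∧ z₁) ∷ (x₁ ∧ y₁ ∧ z₀) ∷ (x₁ ∧ y₁ ∧ z₁) ∷ []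

-- A linear map F_2^n → F_2^m given by the images of the basis vectors.
LinMap : ℕ → ℕ → Set
LinMap n m = Vec (Vec Bool m) n

apply : ∀ {n m} → LinMap n m → Vec Bool n → Vec Bool m
apply {m = m} [] [] = replicate m false
apply (c ∷ cs) (b ∷ bs) = (if b then c else replicate _ false) ⊕₂ apply cs bs

LinIso : LinMap 8 8 → Set
LinIso φ = ∃[ ψ ] ((∀ t → apply ψ (apply φ t) ≡ t) × (∀ p → apply φ (apply ψ p) ≡ p))

Seg : LinMap 8 8 → PtSet
Seg φ p = ∃[ x ] ∃[ y ] ∃[ z ] NZ x × NZ y × NZ z × (apply φ (x ⊗ y ⊗ z) ≡ p)

pureAt : Fin 3 → V2 → V2 → V2 → Tensor
pureAt zero v a b = v ⊗ a ⊗ b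
pureAt (suc zero) v a b = a ⊗ v ⊗ b
pureAt (suc (suc zero)) v a b = a ⊗ b ⊗ v

Generator : LinMap 8 8 → Fin 3 → V2 → V2 → PtSet
Generator φ pos a b p = ∃[ v ] NZ v × (apply φ (pureAt pos v a b) ≡ p)

IsS22 : LinMap 8 8 → PtSet → Set
IsS22 φ X = ∃[ pos ] ∃[ c ] NZ c ×
  (X ≐ (λ p → ∃[ a ] ∃[ b ] NZ a × NZ b × (apply φ (pureAt pos c a b) ≡ p)))

Is3Gen : LinMap 8 8 → PtSet → Set
Is3Gen φ X = ∃[ pos ] ∃ λ (a : Fin 3 → V2) → ∃ λ (b : Fin 3 → V2) →
  (∀ r → NZ (a r)) × (∀ r → NZ (b r)) ×
  (∀ r s → a r ≡ a s → r ≡ s) × (∀ r s → b r ≡ b s → r ≡ s) ×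
  (X ≐ (λ p → ∃[ r ] Generator φ pos (a r) (b r) p))

OnCommonGen : LinMap 8 8 → V8 → V8 → Set
OnCommonGen φ p q = ∃[ pos ] ∃[ a ] ∃[ b ] NZ a × NZ b ×
  Generator φ pos a b p × Generator φ pos a b q

Has9 : PtSet → Set
Has9 X = ∃[ l ] (length l ≡ 9) × Unique l × (∀ p → X p ⇔ (p ∈ l))

IsFan : LinMap 8 8 → PtSet → PtSet → Set
IsFan φ S X = (∀ p → X p → S p) × Has9 X ×
  (∀ p q → X p → X q → p ≢ q → ¬ OnCommonGen φ p q)

{-# OPTIONS --safe #-}
-- Identify the point A λ u of ω₄ with λ ∈ F₃⁴. A 3-dimensional subspace of F₃⁴ is the kernel of
-- a functional f ≢ 𝟎, and it is of kind P₀ iff all coordinates of f are nonzero. In that case f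
-- and its three sign twists d₁, d₂, d₃ (the rows of a Hadamard matrix) form an orthonormal basis
-- of F₃⁴, and the points c·f + s·d₁ + t·d₂ + r·d₃ with c fixed are the pure tensors
-- x_s ⊗ x_t ⊗ x_r of a Segre variety. Every other hyperplane cuts out of it an affine plane
-- αs + βt + γr = e with (α, β, γ) ≢ 0, which is an S₂(2), a 3-generator set or a fan according
-- as one, two or three of α, β, γ are nonzero.
module Submission where

open import Defs
open import Data.Bool using (Bool; true; false; _xor_; if_then_else_)
import Data.Bool.Properties as Bool
open import Data.Fin using (Fin; zero; suc; _≟_; combine; funToFin; finToFun)
open import Data.Fin.Properties
  using (all?; pigeonhole; <⇒≢; finToFun-funToFin; funToFin-finToFin)
open import Data.List using (cartesianProduct; allFin)
import Data.List as List
open import Data.List.Membership.Propositional using (_∈_)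
open import Data.List.Membership.Propositional.Properties
  using (∈-map⁺; ∈-map⁻; ∈-allFin; ∈-cartesianProduct⁺)
open import Data.List.Relation.Unary.Unique.Propositional.Properties
  using (map⁺; cartesianProduct⁺; allFin⁺)
open import Data.Nat using (ℕ; s≤s; z≤n; _^_)
open import Data.Nat.Properties using (^-monoʳ-<; n<1+n)
open import Data.Product using (∃-syntax; _×_; _,_; proj₁; proj₂)
import Data.Product.Properties as Product
open import Data.Sum using (_⊎_; inj₁; inj₂)
open import Data.Vec
  using (Vec; []; _∷_; map; zipWith; replicate; reverse; transpose; lookup; tabulate)
open import Data.Vec.Properties
  using (≡-dec; ∷-injective; zipWith-assoc; zipWith-comm; zipWith-identityˡ; zipWith-identityʳ;
         tabulate∘lookup; lookup∘tabulate; tabulate-cong)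
open import Data.Vec.Relation.Unary.All as All using (All; []; _∷_)
open import Function using (_∘_)
open import Function.Bundles using (_⇔_; mk⇔; module Equivalence)
open import Relation.Binary.PropositionalEquality
  using (_≡_; _≢_; refl; sym; trans; cong; cong₂; subst; module ≡-Reasoning)
open import Relation.Nullary using (¬_; Dec; contradiction)
open import Relation.Nullary.Decidable using (from-yes; map′; _×-dec_; _→-dec_; ¬?)
open import Relation.Unary using (Decidable)

open Equivalence using (to; from)
open ≡-Reasoning

-- Deciding universal statements over finite types

Exhaustible : Set → Set₁
Exhaustible X = ∀ {P : X → Set} → Decidable P → Dec (∀ x → P x)

all-bool? : Exhaustible Bool
all-bool? P? = map′ (λ (f , t) → λ { false → f ; true → t }) (λ h → h false , h true)
                    (P? false ×-dec P? true)

all-vec? : ∀ {X} → Exhaustible X → ∀ n → Exhaustible (Vec X n)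
all-vec? all-X? 0         P? = map′ (λ { p [] → p }) (λ h → h []) (P? [])
all-vec? all-X? (ℕ.suc n) P? =
  map′ (λ { h (x ∷ xs) → h x xs }) (λ h x xs → h (x ∷ xs))
       (all-X? λ x → all-vec? all-X? n λ xs → P? (x ∷ xs))

-- Combined with `from-yes`, this proves a decidable statement about all 81 vectors by evaluation.
all-F3⁴? : Exhaustible F3⁴
all-F3⁴? = all-vec? all? 4

_≟F3⁴_ : (x y : F3⁴) → Dec (x ≡ y)
_≟F3⁴_ = ≡-dec _≟_

_≟V8_ : (x y : V8) → Dec (x ≡ y)
_≟V8_ = ≡-dec Bool._≟_

-- Arithmetic of F₃

+₃-comm : ∀ x y → x +₃ y ≡ y +₃ x
+₃-comm = from-yes (all? λ x → all? λ y → (x +₃ y) ≟ (y +₃ x))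

+₃-identityʳ : ∀ x → x +₃ 0₃ ≡ x
+₃-identityʳ = from-yes (all? λ x → (x +₃ 0₃) ≟ x)

+₃-assoc : ∀ x y z → (x +₃ y) +₃ z ≡ x +₃ (y +₃ z)
+₃-assoc = from-yes (all? λ x → all? λ y → all? λ z → ((x +₃ y) +₃ z) ≟ (x +₃ (y +₃ z)))

+₃-swap : ∀ x y z → x +₃ (y +₃ z) ≡ y +₃ (x +₃ z)
+₃-swap = from-yes (all? λ x → all? λ y → all? λ z → (x +₃ (y +₃ z)) ≟ (y +₃ (x +₃ z)))

+₃-interchange : ∀ w x y z → (w +₃ x) +₃ (y +₃ z) ≡ (w +₃ y) +₃ (x +₃ z)
+₃-interchange = from-yes (all? λ w → all? λ x → all? λ y → all? λ z →
  ((w +₃ x) +₃ (y +₃ z)) ≟ ((w +₃ y) +₃ (x +₃ z)))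

*₃-comm : ∀ x y → x *₃ y ≡ y *₃ x
*₃-comm = from-yes (all? λ x → all? λ y → (x *₃ y) ≟ (y *₃ x))

*₃-zeroʳ : ∀ x → x *₃ 0₃ ≡ 0₃
*₃-zeroʳ = from-yes (all? λ x → (x *₃ 0₃) ≟ 0₃)

*₃-assoc : ∀ x y z → (x *₃ y) *₃ z ≡ x *₃ (y *₃ z)
*₃-assoc = from-yes (all? λ x → all? λ y → all? λ z → ((x *₃ y) *₃ z) ≟ (x *₃ (y *₃ z)))

*₃-distribˡ-+₃ : ∀ x y z → x *₃ (y +₃ z) ≡ (x *₃ y) +₃ (x *₃ z)
*₃-distribˡ-+₃ = from-yes (all? λ x → all? λ y → all? λ z →
  (x *₃ (y +₃ z)) ≟ ((x *₃ y) +₃ (x *₃ z)))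

*₃-distribʳ-+₃ : ∀ x y z → (y +₃ z) *₃ x ≡ (y *₃ x) +₃ (z *₃ x)
*₃-distribʳ-+₃ = from-yes (all? λ x → all? λ y → all? λ z →
  ((y +₃ z) *₃ x) ≟ ((y *₃ x) +₃ (z *₃ x)))

*₃-zero-divisor : ∀ x y → x ≢ 0₃ → x *₃ y ≡ 0₃ → y ≡ 0₃
*₃-zero-divisor = from-yes (all? λ x → all? λ y →
  ¬? (x ≟ 0₃) →-dec (x *₃ y) ≟ 0₃ →-dec y ≟ 0₃)

x-y≡0⇒x≡y : ∀ x y → x +₃ (-₃ y) ≡ 0₃ → x ≡ y
x-y≡0⇒x≡y = from-yes (all? λ x → all? λ y → (x +₃ (-₃ y)) ≟ 0₃ →-dec x ≟ y)

x-x≡0 : ∀ x → x +₃ (-₃ x) ≡ 0₃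
x-x≡0 = from-yes (all? λ x → (x +₃ (-₃ x)) ≟ 0₃)

-- The solution y of x *₃ y +₃ w ≡ e; note that x is its own inverse.
root : F3 → F3 → F3 → F3
root x w e = x *₃ (e +₃ (-₃ w))

root-solves : ∀ x w e → x ≢ 0₃ → (x *₃ root x w e) +₃ w ≡ e
root-solves = from-yes (all? λ x → all? λ w → all? λ e →
  ¬? (x ≟ 0₃) →-dec ((x *₃ root x w e) +₃ w) ≟ e)

root-unique : ∀ x w e y → x ≢ 0₃ → (x *₃ y) +₃ w ≡ e → root x w e ≡ y
root-unique = from-yes (all? λ x → all? λ w → all? λ e → all? λ y →
  ¬? (x ≟ 0₃) →-dec ((x *₃ y) +₃ w) ≟ e →-dec root x w e ≟ y)

-- Linear algebra over F₃

infixl 6 _+ᵛ_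
infixr 7 _*ᵛ_

-- At length 4 these operations unfold to `_⊕_` and `_·_`. Arbitrary length allows induction and
-- covers coefficient vectors. Subtraction is written with the scalar `2₃`, which is -1.
_+ᵛ_ : ∀ {n} → Vec F3 n → Vec F3 n → Vec F3 n
_+ᵛ_ = zipWith _+₃_

_*ᵛ_ : ∀ {n} → F3 → Vec F3 n → Vec F3 n
a *ᵛ x = map (a *₃_) x

0ᵛ : ∀ {n} → Vec F3 n
0ᵛ = replicate _ 0₃

+ᵛ-identityˡ : ∀ {n} (x : Vec F3 n) → 0ᵛ +ᵛ x ≡ x
+ᵛ-identityˡ []      = refl
+ᵛ-identityˡ (x ∷ v) = cong (x ∷_) (+ᵛ-identityˡ v)

+ᵛ-identityʳ : ∀ {n} (x : Vec F3 n) → x +ᵛ 0ᵛ ≡ x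
+ᵛ-identityʳ []      = refl
+ᵛ-identityʳ (x ∷ v) = cong₂ _∷_ (+₃-identityʳ x) (+ᵛ-identityʳ v)

+ᵛ-interchange : ∀ {n} (w x y z : Vec F3 n) → (w +ᵛ x) +ᵛ (y +ᵛ z) ≡ (w +ᵛ y) +ᵛ (x +ᵛ z)
+ᵛ-interchange [] [] [] [] = refl
+ᵛ-interchange (w ∷ ws) (x ∷ xs) (y ∷ ys) (z ∷ zs) =
  cong₂ _∷_ (+₃-interchange w x y z) (+ᵛ-interchange ws xs ys zs)

*ᵛ-zeroˡ : ∀ {n} (x : Vec F3 n) → 0₃ *ᵛ x ≡ 0ᵛ
*ᵛ-zeroˡ []      = refl
*ᵛ-zeroˡ (x ∷ v) = cong (0₃ ∷_) (*ᵛ-zeroˡ v)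

*ᵛ-zeroʳ : ∀ n a → a *ᵛ 0ᵛ {n} ≡ 0ᵛ
*ᵛ-zeroʳ 0         a = refl
*ᵛ-zeroʳ (ℕ.suc n) a = cong₂ _∷_ (*₃-zeroʳ a) (*ᵛ-zeroʳ n a)

*ᵛ-assoc : ∀ {n} a b (x : Vec F3 n) → (a *₃ b) *ᵛ x ≡ a *ᵛ b *ᵛ x
*ᵛ-assoc a b []      = refl
*ᵛ-assoc a b (x ∷ v) = cong₂ _∷_ (*₃-assoc a b x) (*ᵛ-assoc a b v)

*ᵛ-distribˡ : ∀ {n} a (x y : Vec F3 n) → a *ᵛ (x +ᵛ y) ≡ a *ᵛ x +ᵛ a *ᵛ y
*ᵛ-distribˡ a []      []      = refl
*ᵛ-distribˡ a (x ∷ v) (y ∷ w) = cong₂ _∷_ (*₃-distribˡ-+₃ a x y) (*ᵛ-distribˡ a v w)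

*ᵛ-distribʳ : ∀ {n} a b (x : Vec F3 n) → (a +₃ b) *ᵛ x ≡ a *ᵛ x +ᵛ b *ᵛ x
*ᵛ-distribʳ a b []      = refl
*ᵛ-distribʳ a b (x ∷ v) = cong₂ _∷_ (*₃-distribʳ-+₃ x a b) (*ᵛ-distribʳ a b v)

x-y≡0ᵛ⇒x≡y : ∀ {n} (x y : Vec F3 n) → x +ᵛ 2₃ *ᵛ y ≡ 0ᵛ → x ≡ y
x-y≡0ᵛ⇒x≡y []      []      _ = refl
x-y≡0ᵛ⇒x≡y (x ∷ v) (y ∷ w) h with p , q ← ∷-injective h =
  cong₂ _∷_ (x-y≡0⇒x≡y x y p) (x-y≡0ᵛ⇒x≡y v w q)

x-x≡0ᵛ : ∀ {n} (x : Vec F3 n) → x +ᵛ 2₃ *ᵛ x ≡ 0ᵛ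
x-x≡0ᵛ []      = refl
x-x≡0ᵛ (x ∷ v) = cong₂ _∷_ (x-x≡0 x) (x-x≡0ᵛ v)

-- A nonzero `t` is its own inverse, so dividing -y by `t` amounts to multiplying `y` by `-₃ t`.
isolate : ∀ {n} t (x y : Vec F3 n) → t ≢ 0₃ → t *ᵛ x +ᵛ y ≡ 0ᵛ → (-₃ t) *ᵛ y ≡ x
isolate t []      []      _   _ = refl
isolate t (x ∷ v) (y ∷ w) t≢0 h with p , q ← ∷-injective h =
  cong₂ _∷_ (from-yes (all? λ t → all? λ x → all? λ y →
              ¬? (t ≟ 0₃) →-dec ((t *₃ x) +₃ y) ≟ 0₃ →-dec ((-₃ t) *₃ y) ≟ x) t x y t≢0 p)
            (isolate t v w t≢0 q)

lincomb : ∀ {m n} → Vec F3 m → Vec (Vec F3 n) m → Vec F3 n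
lincomb []       []       = 0ᵛ
lincomb (a ∷ as) (v ∷ vs) = a *ᵛ v +ᵛ lincomb as vs

lincomb-+ᵛ : ∀ {m n} (x y : Vec F3 m) (vs : Vec (Vec F3 n) m) →
             lincomb (x +ᵛ y) vs ≡ lincomb x vs +ᵛ lincomb y vs
lincomb-+ᵛ []       []       []       = sym (+ᵛ-identityʳ 0ᵛ)
lincomb-+ᵛ (a ∷ as) (b ∷ bs) (v ∷ vs) = begin
  (a +₃ b) *ᵛ v +ᵛ lincomb (as +ᵛ bs) vs
    ≡⟨ cong₂ _+ᵛ_ (*ᵛ-distribʳ a b v) (lincomb-+ᵛ as bs vs) ⟩
  (a *ᵛ v +ᵛ b *ᵛ v) +ᵛ (lincomb as vs +ᵛ lincomb bs vs)
    ≡⟨ +ᵛ-interchange (a *ᵛ v) _ _ _ ⟩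
  (a *ᵛ v +ᵛ lincomb as vs) +ᵛ (b *ᵛ v +ᵛ lincomb bs vs) ∎

lincomb-*ᵛ : ∀ {m n} a (x : Vec F3 m) (vs : Vec (Vec F3 n) m) →
             lincomb (a *ᵛ x) vs ≡ a *ᵛ lincomb x vs
lincomb-*ᵛ {n = n} a [] [] = sym (*ᵛ-zeroʳ n a)
lincomb-*ᵛ a (b ∷ bs) (v ∷ vs) = begin
  (a *₃ b) *ᵛ v +ᵛ lincomb (a *ᵛ bs) vs
    ≡⟨ cong₂ _+ᵛ_ (*ᵛ-assoc a b v) (lincomb-*ᵛ a bs vs) ⟩
  a *ᵛ b *ᵛ v +ᵛ a *ᵛ lincomb bs vs
    ≡⟨ sym (*ᵛ-distribˡ a (b *ᵛ v) _) ⟩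
  a *ᵛ (b *ᵛ v +ᵛ lincomb bs vs) ∎

-- Linear dependence by counting

decode : ∀ {n} → Fin (3 ^ n) → Vec F3 n
decode i = tabulate (finToFun i)

encode : ∀ {n} → Vec F3 n → Fin (3 ^ n)
encode x = funToFin (lookup x)

funToFin-cong : ∀ {m n} {f g : Fin m → Fin n} → (∀ i → f i ≡ g i) → funToFin f ≡ funToFin g
funToFin-cong {0}       h = refl
funToFin-cong {ℕ.suc m} h = cong₂ combine (h zero) (funToFin-cong (h ∘ suc))

encode-decode : ∀ {n} (i : Fin (3 ^ n)) → encode {n} (decode i) ≡ i
encode-decode {n} i =
  trans (funToFin-cong (lookup∘tabulate (finToFun {3} {n} i))) (funToFin-finToFin {n} i)

decode-encode : ∀ {n} (x : Vec F3 n) → decode (encode x) ≡ x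
decode-encode x = trans (tabulate-cong (finToFun-funToFin (lookup x))) (tabulate∘lookup x)

-- Opaque, since the pigeonhole search is too large to be unfolded.
opaque
  -- Pigeonhole: two of the 3ⁿ⁺¹ combinations agree; take their difference.
  dependent : ∀ n (vs : Vec (Vec F3 n) (ℕ.suc n)) → ∃[ a ] a ≢ 0ᵛ × lincomb a vs ≡ 0ᵛ
  dependent n vs
    with i , j , i<j , eq ← pigeonhole (^-monoʳ-< 3 (s≤s (s≤s z≤n)) (n<1+n n))
                              (λ i → encode {n} (lincomb (decode i) vs))
    = x +ᵛ 2₃ *ᵛ y , nonzero , vanishes
    where
    x y : Vec F3 (ℕ.suc n)
    x = decode i
    y = decode j
    same : lincomb x vs ≡ lincomb y vs
    same = begin
      lincomb x vs                    ≡⟨ sym (decode-encode _) ⟩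
      decode (encode (lincomb x vs))  ≡⟨ cong decode eq ⟩
      decode (encode (lincomb y vs))  ≡⟨ decode-encode _ ⟩
      lincomb y vs                    ∎
    nonzero : x +ᵛ 2₃ *ᵛ y ≢ 0ᵛ
    nonzero h = <⇒≢ i<j (begin
      i         ≡⟨ sym (encode-decode {ℕ.suc n} i) ⟩
      encode x  ≡⟨ cong encode (x-y≡0ᵛ⇒x≡y x y h) ⟩
      encode y  ≡⟨ encode-decode {ℕ.suc n} j ⟩
      j         ∎)
    vanishes : lincomb (x +ᵛ 2₃ *ᵛ y) vs ≡ 0ᵛ
    vanishes = begin
      lincomb (x +ᵛ 2₃ *ᵛ y) vs             ≡⟨ lincomb-+ᵛ x (2₃ *ᵛ y) vs ⟩
      lincomb x vs +ᵛ lincomb (2₃ *ᵛ y) vs  ≡⟨ cong (_ +ᵛ_) (lincomb-*ᵛ 2₃ y vs) ⟩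
      lincomb x vs +ᵛ 2₃ *ᵛ lincomb y vs    ≡⟨ cong (λ z → z +ᵛ 2₃ *ᵛ lincomb y vs) same ⟩
      lincomb y vs +ᵛ 2₃ *ᵛ lincomb y vs    ≡⟨ x-x≡0ᵛ (lincomb y vs) ⟩
      0ᵛ                                    ∎

-- The dot product and hyperplanes as kernels

dot : ∀ {n} → Vec F3 n → Vec F3 n → F3
dot []      []      = 0₃
dot (x ∷ v) (y ∷ w) = (x *₃ y) +₃ dot v w

dot-+ᵛ : ∀ {n} (f x y : Vec F3 n) → dot f (x +ᵛ y) ≡ dot f x +₃ dot f y
dot-+ᵛ []      []      []      = refl
dot-+ᵛ (a ∷ f) (x ∷ v) (y ∷ w) = begin
  (a *₃ (x +₃ y)) +₃ dot f (v +ᵛ w)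
    ≡⟨ cong₂ _+₃_ (*₃-distribˡ-+₃ a x y) (dot-+ᵛ f v w) ⟩
  ((a *₃ x) +₃ (a *₃ y)) +₃ (dot f v +₃ dot f w)
    ≡⟨ +₃-interchange (a *₃ x) _ _ _ ⟩
  ((a *₃ x) +₃ dot f v) +₃ ((a *₃ y) +₃ dot f w) ∎

dot-*ᵛˡ : ∀ {n} a (f x : Vec F3 n) → dot (a *ᵛ f) x ≡ a *₃ dot f x
dot-*ᵛˡ a []      []      = sym (*₃-zeroʳ a)
dot-*ᵛˡ a (b ∷ f) (x ∷ v) =
  trans (cong₂ _+₃_ (*₃-assoc a b x) (dot-*ᵛˡ a f v)) (sym (*₃-distribˡ-+₃ a (b *₃ x) _))

dot-comm : ∀ {n} (f x : Vec F3 n) → dot f x ≡ dot x f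
dot-comm []      []      = refl
dot-comm (a ∷ f) (x ∷ v) = cong₂ _+₃_ (*₃-comm a x) (dot-comm f v)

dot-*ᵛʳ : ∀ {n} a (f x : Vec F3 n) → dot f (a *ᵛ x) ≡ a *₃ dot f x
dot-*ᵛʳ a f x = begin
  dot f (a *ᵛ x)  ≡⟨ dot-comm f _ ⟩
  dot (a *ᵛ x) f  ≡⟨ dot-*ᵛˡ a x f ⟩
  a *₃ dot x f    ≡⟨ cong (a *₃_) (dot-comm x f) ⟩
  a *₃ dot f x    ∎

dot-0ᵛʳ : ∀ {n} (f : Vec F3 n) → dot f 0ᵛ ≡ 0₃
dot-0ᵛʳ []      = refl
dot-0ᵛʳ (a ∷ f) = cong₂ _+₃_ (*₃-zeroʳ a) (dot-0ᵛʳ f)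

dot-lincomb : ∀ {m n} (f : Vec F3 n) (a : Vec F3 m) (vs : Vec (Vec F3 n) m) →
              dot f (lincomb a vs) ≡ dot a (map (dot f) vs)
dot-lincomb f []       []       = dot-0ᵛʳ f
dot-lincomb f (a ∷ as) (v ∷ vs) =
  trans (dot-+ᵛ f (a *ᵛ v) _) (cong₂ _+₃_ (dot-*ᵛʳ a f v) (dot-lincomb f as vs))

-- The witness is the unit vector at the first nonzero coordinate of `f`.
nondegenerate : ∀ {n} (f : Vec F3 n) → f ≢ 0ᵛ → ∃[ w ] dot f w ≢ 0₃
nondegenerate []         f≢0 = contradiction refl f≢0
nondegenerate (zero ∷ f) f≢0 with w , fw≢0 ← nondegenerate f (f≢0 ∘ cong (0₃ ∷_)) = 0₃ ∷ w , fw≢0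
nondegenerate (a@(suc _) ∷ f) _ =
  1₃ ∷ 0ᵛ , λ h → *1-nonzero a (λ ()) (trans (sym (trans (cong ((a *₃ 1₃) +₃_) (dot-0ᵛʳ f))
                                                         (+₃-identityʳ (a *₃ 1₃)))) h)
  where
  *1-nonzero : ∀ a → a ≢ 0₃ → a *₃ 1₃ ≢ 0₃
  *1-nonzero = from-yes (all? λ a → ¬? (a ≟ 0₃) →-dec ¬? ((a *₃ 1₃) ≟ 0₃))

-- The coefficients of f are those of a linear dependency among the rows of the matrix (x y z).
common-annihilator : (x y z : F3⁴) → ∃[ f ] f ≢ 𝟎 × dot f x ≡ 0₃ × dot f y ≡ 0₃ × dot f z ≡ 0₃
-- With all vectors split into coordinates, `transpose` computes, and the entries of the vanishing
-- combination unfold to the three dot products.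
common-annihilator x@(_ ∷ _ ∷ _ ∷ _ ∷ []) y@(_ ∷ _ ∷ _ ∷ _ ∷ []) z@(_ ∷ _ ∷ _ ∷ _ ∷ [])
  with f@(_ ∷ _ ∷ _ ∷ _ ∷ []) , f≢0 , h ← dependent 3 (transpose (x ∷ y ∷ z ∷ []))
  with p , h ← ∷-injective h
  with q , h ← ∷-injective h
  with r , _ ← ∷-injective h
  = f , f≢0 , p , q , r

-- Given f·x ≡ 0, choose w with f·w ≢ 0. The five vectors x, w, b₁, b₂, b₃ of F₃⁴ are dependent;
-- applying f shows that w does not take part, so x does, and x lies in the span of the bᵢ.
annihilator : (V : Subspace3) → ∃[ f ] f ≢ 𝟎 × (∀ x → (x ∈V V) ⇔ (dot f x ≡ 0₃))
annihilator V with f , f≢0 , fb₁ , fb₂ , fb₃ ← common-annihilator (b₁ V) (b₂ V) (b₃ V)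
  = f , f≢0 , λ x → mk⇔ (vanish x) (span x)
  where
  bs : Vec F3⁴ 3
  bs = b₁ V ∷ b₂ V ∷ b₃ V ∷ []

  comb : F3 → F3 → F3 → F3⁴
  comb a b c = (a · b₁ V) ⊕ ((b · b₂ V) ⊕ (c · b₃ V))

  lincomb≡comb : ∀ a b c → lincomb (a ∷ b ∷ c ∷ []) bs ≡ comb a b c
  lincomb≡comb a b c = cong (λ z → (a · b₁ V) ⊕ ((b · b₂ V) ⊕ z)) (+ᵛ-identityʳ _)

  dot-bs : ∀ as → dot f (lincomb as bs) ≡ 0₃
  dot-bs as = begin
    dot f (lincomb as bs)    ≡⟨ dot-lincomb f as bs ⟩
    dot as (map (dot f) bs)  ≡⟨ cong (dot as) (cong₂ _∷_ fb₁ (cong₂ _∷_ fb₂ (cong (_∷ []) fb₃))) ⟩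
    dot as 0ᵛ                ≡⟨ dot-0ᵛʳ as ⟩
    0₃                       ∎

  vanish : ∀ x → x ∈V V → dot f x ≡ 0₃
  vanish x (a , b , c , refl) =
    subst (λ y → dot f y ≡ 0₃) (lincomb≡comb a b c) (dot-bs (a ∷ b ∷ c ∷ []))

  span : ∀ x → dot f x ≡ 0₃ → x ∈V V
  span x fx≡0
    with w , fw≢0 ← nondegenerate f f≢0
    with t ∷ m ∷ as@(a ∷ b ∷ c ∷ []) , nonzero , h ← dependent 4 (x ∷ w ∷ bs)
    = x∈V
    where
    m≡0 : m ≡ 0₃
    m≡0 = *₃-zero-divisor (dot f w) m fw≢0 (begin
      dot f w *₃ m                                     ≡⟨ *₃-comm (dot f w) m ⟩
      m *₃ dot f w                                     ≡⟨ sym (+₃-identityʳ _) ⟩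
      (m *₃ dot f w) +₃ 0₃                             ≡⟨ cong₂ _+₃_ (sym (dot-*ᵛʳ m f w)) (sym (dot-bs as)) ⟩
      dot f (m *ᵛ w) +₃ dot f (lincomb as bs)          ≡⟨ sym (dot-+ᵛ f (m *ᵛ w) _) ⟩
      dot f (m *ᵛ w +ᵛ lincomb as bs)                  ≡⟨ cong (_+₃ dot f (m *ᵛ w +ᵛ lincomb as bs)) (sym ftx≡0) ⟩
      dot f (t *ᵛ x) +₃ dot f (m *ᵛ w +ᵛ lincomb as bs) ≡⟨ sym (dot-+ᵛ f (t *ᵛ x) _) ⟩
      dot f (t *ᵛ x +ᵛ (m *ᵛ w +ᵛ lincomb as bs))      ≡⟨ cong (dot f) h ⟩
      dot f 0ᵛ                                         ≡⟨ dot-0ᵛʳ f ⟩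
      0₃                                               ∎)
      where
      ftx≡0 : dot f (t *ᵛ x) ≡ 0₃
      ftx≡0 = trans (dot-*ᵛʳ t f x) (trans (cong (t *₃_) fx≡0) (*₃-zeroʳ t))

    dependency : t *ᵛ x +ᵛ lincomb as bs ≡ 0ᵛ
    dependency = begin
      t *ᵛ x +ᵛ lincomb as bs                 ≡⟨ cong (t *ᵛ x +ᵛ_) (sym (+ᵛ-identityˡ _)) ⟩
      t *ᵛ x +ᵛ (0ᵛ +ᵛ lincomb as bs)         ≡⟨ cong (λ z → t *ᵛ x +ᵛ (z +ᵛ lincomb as bs)) (sym (*ᵛ-zeroˡ w)) ⟩
      t *ᵛ x +ᵛ (0₃ *ᵛ w +ᵛ lincomb as bs)    ≡⟨ cong (λ m → t *ᵛ x +ᵛ (m *ᵛ w +ᵛ lincomb as bs)) (sym m≡0) ⟩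
      t *ᵛ x +ᵛ (m *ᵛ w +ᵛ lincomb as bs)     ≡⟨ h ⟩
      0ᵛ                                      ∎

    t≢0 : t ≢ 0₃
    -- If `t` were zero, the dependency would only involve the basis of `V`, and independence would
    -- make all five coefficients vanish.
    t≢0 refl with refl , refl , refl ← indep V a b c (begin
      comb a b c                 ≡⟨ sym (lincomb≡comb a b c) ⟩
      lincomb as bs              ≡⟨ sym (+ᵛ-identityˡ _) ⟩
      0ᵛ +ᵛ lincomb as bs        ≡⟨ cong (_+ᵛ lincomb as bs) (sym (*ᵛ-zeroˡ x)) ⟩
      0₃ *ᵛ x +ᵛ lincomb as bs   ≡⟨ dependency ⟩
      0ᵛ                         ∎) = nonzero (cong (λ m → 0₃ ∷ m ∷ 0ᵛ) m≡0)

    x∈V : x ∈V V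
    x∈V = k *₃ a , k *₃ b , k *₃ c , (begin
      comb (k *₃ a) (k *₃ b) (k *₃ c)  ≡⟨ sym (lincomb≡comb (k *₃ a) (k *₃ b) (k *₃ c)) ⟩
      lincomb (k *ᵛ as) bs             ≡⟨ lincomb-*ᵛ k as bs ⟩
      k *ᵛ lincomb as bs               ≡⟨ isolate t x _ t≢0 dependency ⟩
      x                                ∎)
      where k = -₃ t

-- The Segre varieties

Units : ∀ {n} → Vec F3 n → Set
Units = All (_≢ 0₃)

all-units? : {P : F3⁴ → Set} → Decidable P → Dec (∀ f → Units f → P f)
all-units? P? = all-F3⁴? λ f → All.all? (λ x → ¬? (x ≟ 0₃)) f →-dec P? f

-- The coordinates of `f` are its values at the unit vectors, so a zero coordinate would put a unit
-- vector into `V`.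
KindP0⇒Units : ∀ V f → (∀ x → dot f x ≡ 0₃ → x ∈V V) → KindP0 V → Units f
KindP0⇒Units V f ker (p₁ , p₂ , p₃ , p₄) =
  subst Units (coefficients f) (p₁ ∘ ker _ ∷ p₂ ∘ ker _ ∷ p₃ ∘ ker _ ∷ p₄ ∘ ker _ ∷ [])
  where
  coefficients : ∀ f → dot f (1₃ ∷ 0₃ ∷ 0₃ ∷ 0₃ ∷ []) ∷ dot f (0₃ ∷ 1₃ ∷ 0₃ ∷ 0₃ ∷ [])
                     ∷ dot f (0₃ ∷ 0₃ ∷ 1₃ ∷ 0₃ ∷ []) ∷ dot f (0₃ ∷ 0₃ ∷ 0₃ ∷ 1₃ ∷ []) ∷ [] ≡ f
  coefficients = from-yes (all-F3⁴? λ f →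
    (dot f (1₃ ∷ 0₃ ∷ 0₃ ∷ 0₃ ∷ []) ∷ dot f (0₃ ∷ 1₃ ∷ 0₃ ∷ 0₃ ∷ [])
    ∷ dot f (0₃ ∷ 0₃ ∷ 1₃ ∷ 0₃ ∷ []) ∷ dot f (0₃ ∷ 0₃ ∷ 0₃ ∷ 1₃ ∷ []) ∷ []) ≟F3⁴ f)

-- Let `f` have nonzero coordinates. Each of the four vectors then has norm 4 = 1. Any two of them
-- agree in two positions and are opposite in the other two, so their product is 0.
d₁ d₂ d₃ : F3⁴ → F3⁴
d₁ f = zipWith _*₃_ f (1₃ ∷ 1₃ ∷ 2₃ ∷ 2₃ ∷ [])
d₂ f = zipWith _*₃_ f (1₃ ∷ 2₃ ∷ 1₃ ∷ 2₃ ∷ [])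
d₃ f = zipWith _*₃_ f (1₃ ∷ 2₃ ∷ 2₃ ∷ 1₃ ∷ [])

at : F3⁴ → F3 → F3 → F3 → F3 → F3⁴
at f c s t r = (c · f) ⊕ ((s · d₁ f) ⊕ ((t · d₂ f) ⊕ (r · d₃ f)))

-- The coefficients of a vector in an orthonormal basis are its inner products with the basis.
expansion : ∀ f → Units f → ∀ x → at f (dot f x) (dot (d₁ f) x) (dot (d₂ f) x) (dot (d₃ f) x) ≡ x
expansion = from-yes (all-units? λ f → all-F3⁴? λ x →
  at f (dot f x) (dot (d₁ f) x) (dot (d₂ f) x) (dot (d₃ f) x) ≟F3⁴ x)

coordinates : ∀ f → Units f → ∀ c s t r → let x = at f c s t r in
  dot f x ≡ c × dot (d₁ f) x ≡ s × dot (d₂ f) x ≡ t × dot (d₃ f) x ≡ r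
coordinates = from-yes (all-units? λ f → all? λ c → all? λ s → all? λ t → all? λ r →
  let x = at f c s t r in
  dot f x ≟ c ×-dec dot (d₁ f) x ≟ s ×-dec dot (d₂ f) x ≟ t ×-dec dot (d₃ f) x ≟ r)

-- For fixed `c`, a second functional `g` becomes an affine function of `s`, `t`, `r`. Its
-- coefficients decide the type of the section.
dot-at : ∀ g f c s t r → dot g (at f c s t r) ≡
  (c *₃ dot g f) +₃ ((dot g (d₁ f) *₃ s) +₃ ((dot g (d₂ f) *₃ t) +₃ (dot g (d₃ f) *₃ r)))
dot-at g f c s t r =
  trans (dot-+ᵛ g (c *ᵛ f) _) (cong₂ _+₃_ (dot-*ᵛʳ c g f)
    (trans (dot-+ᵛ g (s *ᵛ d₁ f) _) (cong₂ _+₃_ (scale s (d₁ f))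
      (trans (dot-+ᵛ g (t *ᵛ d₂ f) _) (cong₂ _+₃_ (scale t (d₂ f)) (scale r (d₃ f)))))))
  where
  scale : ∀ a x → dot g (a *ᵛ x) ≡ dot g x *₃ a
  scale a x = trans (dot-*ᵛʳ a g x) (*₃-comm a _)

-- In the orthonormal expansion of `g` only the term along `f` survives.
parallel : ∀ f → Units f → ∀ g → dot g (d₁ f) ≡ 0₃ → dot g (d₂ f) ≡ 0₃ → dot g (d₃ f) ≡ 0₃ →
           g ≡ dot g f *ᵛ f
parallel = from-yes (all-units? λ f → all-F3⁴? λ g →
  dot g (d₁ f) ≟ 0₃ →-dec dot g (d₂ f) ≟ 0₃ →-dec dot g (d₃ f) ≟ 0₃ →-dec g ≟F3⁴ (dot g f *ᵛ f))

-- The point A λ u recovers λ: its component in V_a (and likewise in V_c) is (1,1), (1,0), (0,1)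
-- for λ_a = 0, 1, 2; in V_b and V_d the last two are exchanged.
A-injective : ∀ x y → A x u ≡ A y u → x ≡ y
A-injective x y h = trans (sym (exponents-A x)) (trans (cong exponents h) (exponents-A y))
  where
  log : Bool → Bool → F3
  log true  false = 1₃
  log false true  = 2₃
  -- Besides (1,1), which stands for exponent 0, this clause catches (0,0), which is no component of
  -- a point of ω₄.
  log _     _     = 0₃
  exponents : V8 → F3⁴
  exponents (x₁ ∷ x₂ ∷ x₃ ∷ x₄ ∷ x₅ ∷ x₆ ∷ x₇ ∷ x₈ ∷ []) =
    log x₁ x₈ ∷ log x₇ x₂ ∷ log x₃ x₆ ∷ log x₅ x₄ ∷ []
  exponents-A : ∀ x → exponents (A x u) ≡ x
  exponents-A = from-yes (all-F3⁴? λ x → exponents (A x u) ≟F3⁴ x)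

-- Labels 0 and 1 name the basis vectors and 2 names their sum, so a linear map on tensors is fixed
-- by its values at the eight label triples over 0 and 1.
pt : F3 → V2
pt zero             = true , false
pt (suc zero)       = false , true
pt (suc (suc zero)) = true , true

pt-nonzero : ∀ s → NZ (pt s)
pt-nonzero zero             ()
pt-nonzero (suc zero)       ()
pt-nonzero (suc (suc zero)) ()

pt-injective : ∀ {s t} → pt s ≡ pt t → s ≡ t
pt-injective {s} {t} = from-yes (all? λ s → all? λ t → 
  Product.≡-dec Bool._≟_ Bool._≟_ (pt s) (pt t) →-dec s ≟ t) s t

pt-surjective : ∀ x → NZ x → ∃[ s ] pt s ≡ x
pt-surjective (true  , false) _  = 0₃ , refl
pt-surjective (false , true)  _  = 1₃ , refl
pt-surjective (true  , true)  _  = 2₃ , refl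
pt-surjective (false , false) nz = contradiction refl nz

-- φ is an isometry for the symplectic forms V2^⊗3 and V8 = V_a ⊥ V_b ⊥ V_c ⊥ V_d. Both have the
-- antidiagonal Gram matrix, so the inverse ψ of φ is its transpose in the antidiagonal.
φ ψ : F3⁴ → F3 → LinMap 8 8
φ f c = e 0₃ 0₃ 0₃ ∷ e 0₃ 0₃ 1₃ ∷ e 0₃ 1₃ 0₃ ∷ e 0₃ 1₃ 1₃
      ∷ e 1₃ 0₃ 0₃ ∷ e 1₃ 0₃ 1₃ ∷ e 1₃ 1₃ 0₃ ∷ e 1₃ 1₃ 1₃ ∷ []
  where
  e : F3 → F3 → F3 → V8
  e s t r = A (at f c s t r) u
ψ f c = reverse (map reverse (transpose (φ f c)))

-- For labels 0 and 1 this is the definition of `φ`. When one label runs through F₃, every component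
-- of the point runs through a full ζ-orbit, since `d₁ f`, `d₂ f`, `d₃ f` have no zero coordinate.
-- As 1 + ζ + ζ² = 0, the three points sum to zero, which matches `pt 2₃` being the sum of the other
-- two.
φ-pure : ∀ f → Units f → ∀ c s t r →
         apply (φ f c) (pt s ⊗ pt t ⊗ pt r) ≡ A (at f c s t r) u
φ-pure = from-yes (all-units? λ f → all? λ c → all? λ s → all? λ t → all? λ r →
  apply (φ f c) (pt s ⊗ pt t ⊗ pt r) ≟V8 A (at f c s t r) u)

-- Linear maps over F₂ and the invertibility of `φ`

0₂ : ∀ {n} → Vec Bool n
0₂ = replicate _ false

⊕₂-assoc : ∀ {n} (x y z : Vec Bool n) → (x ⊕₂ y) ⊕₂ z ≡ x ⊕₂ (y ⊕₂ z)
⊕₂-assoc = zipWith-assoc Bool.xor-assoc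

⊕₂-identityˡ : ∀ {n} (x : Vec Bool n) → 0₂ ⊕₂ x ≡ x
⊕₂-identityˡ = zipWith-identityˡ Bool.xor-identityˡ

apply-0₂ : ∀ {n m} (M : LinMap n m) → apply M 0₂ ≡ 0₂
apply-0₂ []      = refl
apply-0₂ (c ∷ M) = trans (⊕₂-identityˡ _) (apply-0₂ M)

apply-⊕₂ : ∀ {n m} (M : LinMap n m) x y → apply M (x ⊕₂ y) ≡ apply M x ⊕₂ apply M y
apply-⊕₂ []      []      []      = sym (⊕₂-identityˡ _)
apply-⊕₂ (c ∷ M) (a ∷ x) (b ∷ y) = begin
  [ a xor b ] ⊕₂ apply M (x ⊕₂ y)                  ≡⟨ cong₂ _⊕₂_ (column a b) (apply-⊕₂ M x y) ⟩
  ([ a ] ⊕₂ [ b ]) ⊕₂ (apply M x ⊕₂ apply M y)     ≡⟨ interchange [ a ] [ b ] _ _ ⟩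
  ([ a ] ⊕₂ apply M x) ⊕₂ ([ b ] ⊕₂ apply M y)     ∎
  where
  [_] : Bool → Vec Bool _
  [ b ] = if b then c else 0₂
  self-inverse : ∀ {n} (z : Vec Bool n) → z ⊕₂ z ≡ 0₂
  self-inverse []      = refl
  self-inverse (b ∷ z) = cong₂ _∷_ (Bool.xor-same b) (self-inverse z)
  column : ∀ a b → [ a xor b ] ≡ [ a ] ⊕₂ [ b ]
  column false b     = sym (⊕₂-identityˡ _)
  column true  false = sym (zipWith-identityʳ Bool.xor-identityʳ c)
  column true  true  = sym (self-inverse c)
  interchange : ∀ {n} (w x y z : Vec Bool n) → (w ⊕₂ x) ⊕₂ (y ⊕₂ z) ≡ (w ⊕₂ y) ⊕₂ (x ⊕₂ z)
  interchange w x y z = begin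
    (w ⊕₂ x) ⊕₂ (y ⊕₂ z)  ≡⟨ ⊕₂-assoc w x _ ⟩
    w ⊕₂ (x ⊕₂ (y ⊕₂ z))  ≡⟨ cong (w ⊕₂_) (sym (⊕₂-assoc x y z)) ⟩
    w ⊕₂ ((x ⊕₂ y) ⊕₂ z)  ≡⟨ cong (λ v → w ⊕₂ (v ⊕₂ z)) (zipWith-comm Bool.xor-comm x y) ⟩
    w ⊕₂ ((y ⊕₂ x) ⊕₂ z)  ≡⟨ cong (w ⊕₂_) (⊕₂-assoc y x z) ⟩
    w ⊕₂ (y ⊕₂ (x ⊕₂ z))  ≡⟨ sym (⊕₂-assoc w y _) ⟩
    (w ⊕₂ y) ⊕₂ (x ⊕₂ z)  ∎

apply-∘ : ∀ {k n m} (N : LinMap n m) (M : LinMap k n) t →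
          apply N (apply M t) ≡ apply (map (apply N) M) t
apply-∘ N []      []          = apply-0₂ N
apply-∘ N (c ∷ M) (true ∷ t)  = trans (apply-⊕₂ N c _) (cong (apply N c ⊕₂_) (apply-∘ N M t))
apply-∘ N (c ∷ M) (false ∷ t) =
  trans (apply-⊕₂ N 0₂ _) (cong₂ _⊕₂_ (apply-0₂ N) (apply-∘ N M t))

identity : ∀ {n} → LinMap n n
identity {0}       = []
identity {ℕ.suc n} = (true ∷ 0₂) ∷ map (false ∷_) identity

apply-identity : (t : V8) → apply identity t ≡ t
apply-identity = from-yes (all-vec? all-bool? 8 λ t → apply identity t ≟V8 t)

-- By linearity only the eight columns have to be compared, which keeps the check over all `f` and
-- `c` small.
map-apply≡identity⇒inverse : ∀ (M N : LinMap 8 8) → map (apply N) M ≡ identity →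
                             ∀ t → apply N (apply M t) ≡ t
map-apply≡identity⇒inverse M N h t =
  trans (apply-∘ N M t) (trans (cong (λ L → apply L t) h) (apply-identity t))

ψ-inverse : ∀ f → Units f → ∀ c → map (apply (ψ f c)) (φ f c) ≡ identity
                                × map (apply (φ f c)) (ψ f c) ≡ identity
ψ-inverse = from-yes (all-units? λ f → all? λ c → 
  ≡-dec _≟V8_ (map (apply (ψ f c)) (φ f c)) identity ×-dec
  ≡-dec _≟V8_ (map (apply (φ f c)) (ψ f c)) identity)

φ-iso : ∀ f → Units f → ∀ c → LinIso (φ f c)
φ-iso f f-units c =
  ψ f c , map-apply≡identity⇒inverse (φ f c) (ψ f c) (proj₁ (ψ-inverse f f-units c))
        , map-apply≡identity⇒inverse (ψ f c) (φ f c) (proj₂ (ψ-inverse f f-units c))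

-- Hyperplane sections

≐-trans : ∀ {X Y Z} → X ≐ Y → Y ≐ Z → X ≐ Z
≐-trans h k p = mk⇔ (to (k p) ∘ to (h p)) (from (h p) ∘ from (k p))

Level : F3⁴ → F3 → PtSet
Level f c p = ∃[ x ] (dot f x ≡ c) × (A x u ≡ p)

-- The coset of `μ` depends only on the value of `f` at `μ`; the three possible values give the
-- three cosets.
CosetSet≐Level : ∀ V f → (∀ x → (x ∈V V) ⇔ (dot f x ≡ 0₃)) → ∀ μ →
                 CosetSet V μ ≐ Level f (dot f μ)
CosetSet≐Level V f ker μ p = mk⇔
  (λ (x , x-μ∈V , eq) → x , x-y≡0⇒x≡y _ _ (trans (sym (dot-⊖ x)) (to (ker _) x-μ∈V)) , eq)
  (λ (x , fx≡fμ , eq) → x , from (ker _) (trans (dot-⊖ x)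
    (trans (cong (_+₃ (-₃ dot f μ)) fx≡fμ) (x-x≡0 (dot f μ)))) , eq)
  where
  dot-⊖ : ∀ x → dot f (x ⊖ μ) ≡ dot f x +₃ (-₃ dot f μ)
  dot-⊖ x = trans (dot-+ᵛ f x (2₃ *ᵛ μ)) (cong (dot f x +₃_) (dot-*ᵛʳ 2₃ f μ))

module _ (f : F3⁴) (f-units : Units f) where

  private
    at-coordinates : ∀ x {c} → dot f x ≡ c →
                     at f c (dot (d₁ f) x) (dot (d₂ f) x) (dot (d₃ f) x) ≡ x
    at-coordinates x refl = expansion f f-units x

  Level≐Seg : ∀ c → Level f c ≐ Seg (φ f c)
  Level≐Seg c p = mk⇔ forth back
    where
    forth : Level f c p → Seg (φ f c) p
    forth (x , fx≡c , eq) =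
      pt s , pt t , pt r , pt-nonzero s , pt-nonzero t , pt-nonzero r ,
      trans (φ-pure f f-units c s t r) (trans (cong (λ x → A x u) (at-coordinates x fx≡c)) eq)
      where
      s t r : F3
      s = dot (d₁ f) x
      t = dot (d₂ f) x
      r = dot (d₃ f) x
    back : Seg (φ f c) p → Level f c p
    back (x , y , z , x≢0 , y≢0 , z≢0 , eq)
      with s , refl ← pt-surjective x x≢0
      with t , refl ← pt-surjective y y≢0
      with r , refl ← pt-surjective z z≢0
      = at f c s t r , proj₁ (coordinates f f-units c s t r) ,
        trans (sym (φ-pure f f-units c s t r)) eq

-- Affine planes in the coordinates of the Segre variety

PureInjective : LinMap 8 8 → Set
PureInjective M = ∀ pos {v a b v′ a′ b′} →
  apply M (pureAt pos (pt v) (pt a) (pt b)) ≡ apply M (pureAt pos (pt v′) (pt a′) (pt b′)) →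
  v ≡ v′ × a ≡ a′ × b ≡ b′

-- The point determines its exponent vector by `A-injective`, and the inner products with `d₁ f`,
-- `d₂ f`, `d₃ f` recover the labels.
φ-pure-injective : ∀ f → Units f → ∀ c → PureInjective (φ f c)
φ-pure-injective f f-units c = λ
  { zero             h → injective h
  ; (suc zero)       h → let p , q , r = injective h in q , p , r
  ; (suc (suc zero)) h → let p , q , r = injective h in r , p , q
  }
  where
  injective : ∀ {s t r s′ t′ r′} →
              apply (φ f c) (pt s ⊗ pt t ⊗ pt r) ≡ apply (φ f c) (pt s′ ⊗ pt t′ ⊗ pt r′) →
              s ≡ s′ × t ≡ t′ × r ≡ r′
  injective {s} {t} {r} {s′} {t′} {r′} h =
    let _ , p , q , o = coordinates f f-units c s t r
        _ , p′ , q′ , o′ = coordinates f f-units c s′ t′ r′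
        same = A-injective (at f c s t r) (at f c s′ t′ r′)
                 (trans (sym (φ-pure f f-units c s t r)) (trans h (φ-pure f f-units c s′ t′ r′)))
    in trans (sym p) (trans (cong (dot (d₁ f)) same) p′)
     , trans (sym q) (trans (cong (dot (d₂ f)) same) q′)
     , trans (sym o) (trans (cong (dot (d₃ f)) same) o′)

-- A data type rather than a nested Σ, so that the parameters can be inferred.
data Plane (M : LinMap 8 8) (pos : Fin 3) (α β γ e : F3) (p : V8) : Set where
  plane : ∀ v a b → (α *₃ v) +₃ ((β *₃ a) +₃ (γ *₃ b)) ≡ e →
          apply M (pureAt pos (pt v) (pt a) (pt b)) ≡ p → Plane M pos α β γ e p

-- The same plane with another tensor factor singled out as `v`; the coefficient of that factor
-- comes first. This lets each type of section be treated in one direction only.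
Plane-at1 : ∀ {M} α β γ {e} → Plane M zero α β γ e ≐ Plane M (suc zero) β α γ e
Plane-at1 α β γ p = mk⇔
  (λ { (plane v a b h k) → plane a v b (trans (+₃-swap (β *₃ a) (α *₃ v) (γ *₃ b)) h) k })
  (λ { (plane v a b h k) → plane a v b (trans (+₃-swap (α *₃ a) (β *₃ v) (γ *₃ b)) h) k })

Plane-at2 : ∀ {M} α β γ {e} → Plane M zero α β γ e ≐ Plane M (suc (suc zero)) γ α β e
Plane-at2 α β γ p = mk⇔
  (λ { (plane v a b h k) →
       plane b v a (trans (rotate (γ *₃ b) (α *₃ v) (β *₃ a)) h) k })
  (λ { (plane v a b h k) →
       plane a b v (trans (sym (rotate (γ *₃ v) (α *₃ a) (β *₃ b))) h) k })
  where
  rotate : ∀ x y z → x +₃ (y +₃ z) ≡ y +₃ (z +₃ x)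
  rotate x y z = trans (+₃-comm x _) (+₃-assoc y z x)

-- A common point has one exponent vector by `A-injective`, so both conditions apply to the same
-- vector. Writing it in the basis of `f` turns the condition on `g` into an affine equation, with
-- the constant term moved to the right.
Level∩Level≐Plane : ∀ f → Units f → ∀ g c e → (Level f c ∩ Level g e) ≐
  Plane (φ f c) zero (dot g (d₁ f)) (dot g (d₂ f)) (dot g (d₃ f)) (e +₃ (-₃ (c *₃ dot g f)))
Level∩Level≐Plane f f-units g c e p = mk⇔ forth back
  where
  κ e′ : F3
  κ = c *₃ dot g f
  e′ = e +₃ (-₃ κ)
  section : F3 → F3 → F3 → F3
  section s t r = (dot g (d₁ f) *₃ s) +₃ ((dot g (d₂ f) *₃ t) +₃ (dot g (d₃ f) *₃ r))

  forth : (Level f c ∩ Level g e) p → Plane (φ f c) zero _ _ _ e′ p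
  forth ((x , refl , eq) , (y , gy≡e , eq′)) =
    plane s t r
    -- `root 1₃ κ e` computes to `e′`, so this moves `κ` to the other side of the equation.
    (sym (root-unique 1₃ κ e (section s t r) (λ ()) (begin
      section s t r +₃ κ     ≡⟨ +₃-comm (section s t r) κ ⟩
      κ +₃ section s t r     ≡⟨ sym (dot-at g f c s t r) ⟩
      dot g (at f c s t r)   ≡⟨ cong (dot g) (expansion f f-units x) ⟩
      dot g x                ≡⟨ cong (dot g) (A-injective x y (trans eq (sym eq′))) ⟩
      dot g y                ≡⟨ gy≡e ⟩
      e                      ∎)))
    (trans (φ-pure f f-units c s t r)
      (trans (cong (λ x → A x u) (expansion f f-units x)) eq))
    where
    s t r : F3
    s = dot (d₁ f) x
    t = dot (d₂ f) x
    r = dot (d₃ f) x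

  back : Plane (φ f c) zero _ _ _ e′ p → (Level f c ∩ Level g e) p
  back (plane s t r h k) =
    (at f c s t r , proj₁ (coordinates f f-units c s t r) , point) ,
    (at f c s t r , level , point)
    where
    point : A (at f c s t r) u ≡ p
    point = trans (sym (φ-pure f f-units c s t r)) k
    level : dot g (at f c s t r) ≡ e
    level = begin
      dot g (at f c s t r)  ≡⟨ dot-at g f c s t r ⟩
      κ +₃ section s t r    ≡⟨ +₃-comm κ _ ⟩
      section s t r +₃ κ    ≡⟨ cong (_+₃ κ) h ⟩
      e′ +₃ κ               ≡⟨ root-solves 1₃ κ e (λ ()) ⟩
      e                     ∎

-- The three types of section

-- The equation fixes the label `v` and leaves the other two factors free.
S22-case : ∀ {M X} pos {α e} → α ≢ 0₃ → X ≐ Plane M pos α 0₃ 0₃ e → IsS22 M X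
S22-case {M} pos {α} {e} α≢0 h =
  pos , pt (root α 0₃ e) , pt-nonzero (root α 0₃ e) , ≐-trans h λ p → mk⇔ forth back
  where
  S22 : PtSet
  S22 p = ∃[ a ] ∃[ b ] NZ a × NZ b × (apply M (pureAt pos (pt (root α 0₃ e)) a b) ≡ p)
  forth : ∀ {p} → Plane M pos α 0₃ 0₃ e p → S22 p
  forth (plane v a b eq k) rewrite root-unique α 0₃ e v α≢0 eq =
    pt a , pt b , pt-nonzero a , pt-nonzero b , k
  back : ∀ {p} → S22 p → Plane M pos α 0₃ 0₃ e p
  back (a , b , a≢0 , b≢0 , k)
    with a , refl ← pt-surjective a a≢0
    with b , refl ← pt-surjective b b≢0
    = plane (root α 0₃ e) a b (root-solves α 0₃ e α≢0) k

-- The factor `v` is free, so the plane is a union of parallel generators. With both coefficients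
-- nonzero, the line βa + γb = e is the graph of a bijection, which makes both label sequences
-- injective.
3Gen-case : ∀ {M X} pos {β γ e} → β ≢ 0₃ → γ ≢ 0₃ → X ≐ Plane M pos 0₃ β γ e → Is3Gen M X
3Gen-case {M} pos {β} {γ} {e} β≢0 γ≢0 h =
  pos , pt , pt ∘ b , pt-nonzero , pt-nonzero ∘ b , (λ _ _ → pt-injective) ,
  (λ r s → b-injective r s ∘ pt-injective) , ≐-trans h λ p → mk⇔ forth back
  where
  b : F3 → F3
  b r = root γ (β *₃ r) e
  b-injective : ∀ r s → b r ≡ b s → r ≡ s
  b-injective r s = from-yes (all? λ β → all? λ γ → all? λ e → all? λ r → all? λ s →
    ¬? (β ≟ 0₃) →-dec ¬? (γ ≟ 0₃) →-dec
    root γ (β *₃ r) e ≟ root γ (β *₃ s) e →-dec r ≟ s) β γ e r s β≢0 γ≢0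
  Generators : PtSet
  Generators p = ∃[ r ] Generator M pos (pt r) (pt (b r)) p
  forth : ∀ {p} → Plane M pos 0₃ β γ e p → Generators p
  forth (plane v r s eq k)
    with refl ← root-unique γ (β *₃ r) e s γ≢0 (trans (+₃-comm (γ *₃ s) _) eq)
    = r , pt v , pt-nonzero v , k
  back : ∀ {p} → Generators p → Plane M pos 0₃ β γ e p
  back (r , v , v≢0 , k) with v , refl ← pt-surjective v v≢0 =
    plane v r (b r) (trans (+₃-comm (β *₃ r) _) (root-solves γ (β *₃ r) e γ≢0)) k

-- Along a generator in direction `pos` only `v` varies, and since `α` is nonzero the equation of
-- the plane determines `v` from the other two labels.
no-common-generator : ∀ {M X} pos {α β γ e} → PureInjective M → α ≢ 0₃ →
  X ≐ Plane M pos α β γ e → ∀ {a b p q} → NZ a → NZ b → X p → X q →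
  Generator M pos a b p → Generator M pos a b q → p ≡ q
no-common-generator {M} {X} pos {α} {β} {γ} {e} inj α≢0 h a≢0 b≢0 Xp Xq
  (v , v≢0 , refl) (w , w≢0 , refl)
  with a , refl ← pt-surjective _ a≢0
  with b , refl ← pt-surjective _ b≢0
  with v , refl ← pt-surjective v v≢0
  with w , refl ← pt-surjective w w≢0
  = cong (λ v → apply M (pureAt pos (pt v) (pt a) (pt b)))
         (trans (sym (determined v Xp)) (determined w Xq))
  where
  determined : ∀ v → X (apply M (pureAt pos (pt v) (pt a) (pt b))) →
               root α ((β *₃ a) +₃ (γ *₃ b)) e ≡ v
  determined v Xv with plane v′ a′ b′ eq k ← to (h _) Xv with refl , refl , refl ← inj pos k =
    root-unique α _ e v α≢0 eq

-- Solving for the first label parametrises the plane by the nine pairs of the other two. Every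
-- coefficient is nonzero, so `no-common-generator` applies in all three directions.
fan-case : ∀ {M S X} {α β γ e} → PureInjective M → α ≢ 0₃ → β ≢ 0₃ → γ ≢ 0₃ →
           (∀ p → X p → S p) → X ≐ Plane M zero α β γ e → IsFan M S X
fan-case {M} {S} {X} {α} {β} {γ} {e} inj α≢0 β≢0 γ≢0 X⊆S h = X⊆S , nine , no-common
  where
  v : F3 × F3 → F3
  v (a , b) = root α ((β *₃ a) +₃ (γ *₃ b)) e
  point : F3 × F3 → V8
  point (a , b) = apply M (pt (v (a , b)) ⊗ pt a ⊗ pt b)
  pairs : List.List (F3 × F3)
  pairs = cartesianProduct (allFin 3) (allFin 3)
  nine : Has9 X
  nine = List.map point pairs , refl ,
    map⁺ {f = point} (λ {x} {y} eq →
           let _ , p , q = inj zero {v x} {proj₁ x} {proj₂ x} {v y} {proj₁ y} {proj₂ y} eq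
           in cong₂ _,_ p q)
         (cartesianProduct⁺ (allFin⁺ 3) (allFin⁺ 3)) ,
    ≐-trans h λ p → mk⇔ forth back
    where
    forth : ∀ {p} → Plane M zero α β γ e p → p ∈ List.map point pairs
    forth (plane w a b eq refl) with refl ← root-unique α _ e w α≢0 eq =
      ∈-map⁺ point (∈-cartesianProduct⁺ (∈-allFin a) (∈-allFin b))
    back : ∀ {p} → p ∈ List.map point pairs → Plane M zero α β γ e p
    back p∈ with (a , b) , _ , refl ← ∈-map⁻ point p∈ =
      plane (v (a , b)) a b (root-solves α _ e α≢0) refl
  no-common : ∀ p q → X p → X q → p ≢ q → ¬ OnCommonGen M p q
  no-common p q Xp Xq p≢q (pos , a , b , a≢0 , b≢0 , Gp , Gq) = p≢q (meet pos Gp Gq)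
    where
    meet : ∀ pos → Generator M pos a b p → Generator M pos a b q → p ≡ q
    meet zero             = no-common-generator zero inj α≢0 h a≢0 b≢0 Xp Xq
    meet (suc zero)       = no-common-generator (suc zero) inj β≢0
                              (≐-trans h (Plane-at1 α β γ)) a≢0 b≢0 Xp Xq
    meet (suc (suc zero)) = no-common-generator (suc (suc zero)) inj γ≢0
                              (≐-trans h (Plane-at2 α β γ)) a≢0 b≢0 Xp Xq

-- A single nonzero coefficient is moved to the front for `S22-case`, and a single zero coefficient
-- for `3Gen-case`.
classify-Plane : ∀ {M S X} α β γ {e} → PureInjective M → ¬ (α ≡ 0₃ × β ≡ 0₃ × γ ≡ 0₃) →
  (∀ p → X p → S p) → X ≐ Plane M zero α β γ e → IsS22 M X ⊎ Is3Gen M X ⊎ IsFan M S X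
classify-Plane zero zero zero inj ≢0 X⊆S h = contradiction (refl , refl , refl) ≢0
classify-Plane (suc _) zero zero inj ≢0 X⊆S h = inj₁ (S22-case zero (λ ()) h)
classify-Plane zero β@(suc _) zero inj ≢0 X⊆S h =
  inj₁ (S22-case (suc zero) (λ ()) (≐-trans h (Plane-at1 0₃ β 0₃)))
classify-Plane zero zero γ@(suc _) inj ≢0 X⊆S h =
  inj₁ (S22-case (suc (suc zero)) (λ ()) (≐-trans h (Plane-at2 0₃ 0₃ γ)))
classify-Plane zero (suc _) (suc _) inj ≢0 X⊆S h = inj₂ (inj₁ (3Gen-case zero (λ ()) (λ ()) h))
classify-Plane α@(suc _) zero γ@(suc _) inj ≢0 X⊆S h =
  inj₂ (inj₁ (3Gen-case (suc zero) (λ ()) (λ ()) (≐-trans h (Plane-at1 α 0₃ γ))))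
classify-Plane α@(suc _) β@(suc _) zero inj ≢0 X⊆S h =
  inj₂ (inj₁ (3Gen-case (suc (suc zero)) (λ ()) (λ ()) (≐-trans h (Plane-at2 α β 0₃))))
classify-Plane (suc _) (suc _) (suc _) inj ≢0 X⊆S h =
  inj₂ (inj₂ (fan-case inj (λ ()) (λ ()) (λ ()) X⊆S h))

-- From functionals back to subspaces and cosets

proportional⇒SameSubspace : ∀ V W f g {k} → (∀ x → (x ∈V V) ⇔ (dot f x ≡ 0₃)) →
  (∀ x → (x ∈V W) ⇔ (dot g x ≡ 0₃)) → k ≢ 0₃ → g ≡ k *ᵛ f → SameSubspace V W
proportional⇒SameSubspace V W f g {k} kerV kerW k≢0 refl x = mk⇔
  (λ x∈V → from (kerW x) (trans (dot-*ᵛˡ k f x) (trans (cong (k *₃_) (to (kerV x) x∈V)) (*₃-zeroʳ k))))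
  (λ x∈W → from (kerV x) (*₃-zero-divisor k _ k≢0 (trans (sym (dot-*ᵛˡ k f x)) (to (kerW x) x∈W))))

theorem9 : (V W : Subspace3) → KindP0 V → ¬ SameSubspace V W → (μ ν : F3⁴) →
    ∃[ φ ] LinIso φ × (CosetSet V μ ≐ Seg φ) ×
    (IsS22 φ (CosetSet V μ ∩ CosetSet W ν)
    ⊎ Is3Gen φ (CosetSet V μ ∩ CosetSet W ν)
    ⊎ IsFan φ (CosetSet V μ) (CosetSet V μ ∩ CosetSet W ν))
theorem9 V W V-P0 V≢W μ ν
  with f , _ , kerV ← annihilator V
  with g , g≢𝟎 , kerW ← annihilator W
  = φ f c , φ-iso f f-units c , ≐-trans coset-V (Level≐Seg f f-units c) ,
    classify-Plane (dot g (d₁ f)) (dot g (d₂ f)) (dot g (d₃ f)) (φ-pure-injective f f-units c)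
      not-parallel (λ _ → proj₁) (≐-trans section (Level∩Level≐Plane f f-units g c (dot g ν)))
  where
  c : F3
  c = dot f μ
  f-units : Units f
  f-units = KindP0⇒Units V f (from ∘ kerV) V-P0
  coset-V : CosetSet V μ ≐ Level f c
  coset-V = CosetSet≐Level V f kerV μ
  coset-W : CosetSet W ν ≐ Level g (dot g ν)
  coset-W = CosetSet≐Level W g kerW ν
  section : (CosetSet V μ ∩ CosetSet W ν) ≐ (Level f c ∩ Level g (dot g ν))
  section p = mk⇔ (λ (v , w) → to (coset-V p) v , to (coset-W p) w)
                  (λ (v , w) → from (coset-V p) v , from (coset-W p) w)
  not-parallel : ¬ (dot g (d₁ f) ≡ 0₃ × dot g (d₂ f) ≡ 0₃ × dot g (d₃ f) ≡ 0₃)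
  -- If all three coefficients vanished, `g` would be a multiple of `f`, by a nonzero scalar because
  -- `g` is nonzero, and the two hyperplanes would coincide.
  not-parallel (p , q , r) = V≢W (proportional⇒SameSubspace V W f g kerV kerW κ≢0 g≡κf)
    where
    g≡κf : g ≡ dot g f *ᵛ f
    g≡κf = parallel f f-units g p q r
    κ≢0 : dot g f ≢ 0₃
    κ≢0 κ≡0 = g≢𝟎 (trans g≡κf (trans (cong (_*ᵛ f) κ≡0) (*ᵛ-zeroˡ f)))
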